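{- Let $n,k$ be integers with $1\le k\le \frac n2-1$, and let $T\in\mathcal T_{n,k}$. Then $$\prod\nolimits_2(T)\ \ge\ (3^3)^{k}(2^2)^{\,n-2k-2}=\left(\tfrac{27}{16}\right)^{k}4^{\,n-2},$$ and equality holds if and only if the degree sequence of $T$ is $$(\underbrace{3,\ldots,3}_{k},\underbrace{2,\ldots,2}_{n-2k-2},\underbrace{1,\ldots,1}_{k+2}).$$
   Context: All graphs are finite, simple, connected and undirected; $d(v)$ denotes the degree of a vertex $v$. $\mathcal T_{n,k}$ is the class of trees with $n$ vertices in which exactly $k$ vertices have degree equal to the maximum vertex degree of the tree. The second multiplicative Zagreb index of a graph $G$ is $\prod_2(G)=\prod_{uv\in E(G)}d(u)d(v)=\prod_{u\in V(G)}d(u)^{d(u)}$. The degree sequence of a graph is the list of its vertex degrees in non-increasing order. -}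

module Defs where

open import Data.Fin.Base using (Fin)
open import Data.Fin.Properties using (_<?_)
open import Data.List.Base
  using (List; _∷_; _∷ʳ_; allFin; cartesianProduct; filter; foldr; length; map)
open import Data.List.Relation.Unary.Linked using (Linked)
open import Data.List.Relation.Unary.Unique.Propositional using (Unique)
import Data.List.Sort as Sort
open import Data.Nat.Base using (ℕ; _*_; _≤_; _⊔_)
open import Data.Nat.ListAction using (product)
open import Data.Nat.Properties using (_≟_; ≤-decTotalOrder)
open import Data.Product.Base using (_×_; _,_)
import Data.Rational.Base as ℚ
open import Level using (0ℓ)
open import Relation.Binary.Core using (Rel)
open import Relation.Binary.Definitions using (Decidable; Irreflexive; Symmetric)
open import Relation.Binary.Construct.Closure.ReflexiveTransitive using (Star)
open import Relation.Binary.Properties.DecTotalOrder ≤-decTotalOrder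
  using (≥-decTotalOrder)
open import Relation.Binary.PropositionalEquality.Core using (_≡_)
open import Relation.Nullary.Decidable using (_×-dec_)
open import Relation.Nullary.Negation using (¬_)
open import Algebra.Definitions.RawSemiring ℚ.+-*-rawSemiring public
  using () renaming (_^_ to _^ℚ_)

record Graph (n : ℕ) : Set₁ where
  infix 4 _~_ _~?_
  field
    _~_    : Rel (Fin n) 0ℓ
    _~?_   : Decidable _~_
    symm   : Symmetric _~_
    irrefl : Irreflexive _≡_ _~_

module _ {n : ℕ} (G : Graph n) where
  open Graph G

  Connected : Set
  Connected = ∀ u v → Star _~_ u v

  -- A cycle is v, w₁, …, wₘ, v with v, w₁, …, wₘ distinct.  Requiring m ≥ 2
  -- excludes walking along an edge and straight back.
  record Cycle : Set where
    field
      v        : Fin n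
      ws       : List (Fin n)
      long     : 2 ≤ length ws
      distinct : Unique (v ∷ ws)
      closed   : Linked _~_ (v ∷ ws ∷ʳ v)

  IsTree : Set
  IsTree = Connected × ¬ Cycle

  degree : Fin n → ℕ
  degree u = length (filter (u ~?_) (allFin n))

  degrees : List ℕ
  degrees = map degree (allFin n)

  maxDegree : ℕ
  maxDegree = foldr _⊔_ 0 degrees

  degreeSequence : List ℕ
  degreeSequence = Sort.sort ≥-decTotalOrder degrees

  -- Each undirected edge is listed once, with its smaller endpoint first.
  edges : List (Fin n × Fin n)
  edges = filter (λ (u , v) → (u <? v) ×-dec (u ~? v))
                 (cartesianProduct (allFin n) (allFin n))

  Π₂ : ℕ
  Π₂ = product (map (λ (u , v) → degree u * degree v) edges)

-- 𝒯 n k T says that the graph T on n vertices belongs to the class 𝒯_{n,k}.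
𝒯 : (n k : ℕ) → Graph n → Set
𝒯 n k T =
  IsTree T × length (filter (λ v → degree T v ≟ maxDegree T) (allFin n)) ≡ k

{-# OPTIONS --safe #-}
-- The function d ↦ d ln d is convex, and 4 · dᵈ ≥ 4ᵈ compares it with its chord
-- through d = 1 and d = 2; for d ≥ 3 the factor 4 can be improved to 64/27, with
-- equality only at d = 3.  Multiplying these bounds over all vertices, and using
-- that a connected graph has degree sum at least 2n − 2, gives the inequality;
-- equality forces it in every factor.  That the maximum degree is at least 3
-- comes from the same degree sum bound together with 2k + 2 ≤ n.
module Submission where

open import Defs
open import Algebra.Core using (Op₂)
import Algebra.Properties.CommutativeSemiring.Exp as CommutativeExp
import Algebra.Properties.CommutativeSemigroup as CommutativeSemigroupProperties
import Algebra.Properties.Semiring.Exp as Exp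
open import Algebra.Bundles using (CommutativeRing; CommutativeSemigroup)
open import Algebra.Structures using (IsCommutativeMonoid)
open import Data.Bool.Base using (if_then_else_)
open import Data.Empty using (⊥-elim)
open import Data.Fin.Base as Fin using (Fin; zero; suc)
import Data.Fin.Properties as Fin
open import Data.Integer.Base using (+_)
open import Data.Integer.Properties using (pos-*)
open import Data.List.Base
  using (List; []; _∷_; _++_; allFin; cartesianProduct; filter; foldr; length; map;
         replicate; tabulate)
import Data.List.Membership.DecPropositional as DecMembership
open import Data.List.Membership.Propositional using (_∈_)
open import Data.List.Membership.Propositional.Properties
  using (∈-allFin; ∈-∃++; ∈-++⁻; ∈-map⁺; ∈-tabulate⁻)
open import Data.List.Properties
  using (++-assoc; ++-identityʳ; length-++; length-replicate; length-map;
         length-tabulate; map-∘; map-replicate)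
open import Data.List.Relation.Binary.Permutation.Propositional
  using (_↭_; ↭-refl; ↭-reflexive; ↭-sym; ↭-trans; ↭⇒↭ₛ; prep)
open import Data.List.Relation.Binary.Permutation.Propositional.Properties
  using (++⁺ˡ; map⁺; shift; ↭-length; ∈-resp-↭)
open import Data.List.Relation.Binary.Pointwise using (Pointwise-≡⇒≡)
open import Data.List.Relation.Unary.Any using (here; there)
open import Data.List.Relation.Unary.All using (All; [])
import Data.List.Relation.Unary.All.Properties as All
open import Data.List.Relation.Unary.AllPairs using (AllPairs; []; _∷_)
import Data.List.Sort as Sort
open import Data.List.Relation.Unary.Sorted.TotalOrder.Properties using (AllPairs⇒Sorted; ↗↭↗⇒≋)
open import Data.Nat.Base hiding (_/_)
open import Data.Nat.ListAction using (sum; product)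
open import Data.Nat.ListAction.Properties using (sum-↭; product-↭; sum-++)
open import Data.Nat.Properties
open import Data.Nat.Tactic.RingSolver using (solve-∀)
open import Data.Product.Base using (∃₂; _×_; _,_)
open import Data.Rational.Base using (_/_; ℚ; toℚᵘ) renaming (_*_ to _*ℚ_)
import Data.Rational.Properties as ℚ
open import Data.Rational.Unnormalised.Base using (mkℚᵘ) renaming (_*_ to _*ℚᵘ_)
import Data.Rational.Unnormalised.Properties as ℚᵘ
open import Data.Sum.Base using (_⊎_; inj₁; inj₂; [_,_]′)
open import Function.Base using (const; _∘_)
open import Function.Bundles using (Equivalence; _⇔_; mk⇔)
open import Relation.Binary.Construct.Closure.ReflexiveTransitive using (Star; ε; _◅_)
open import Relation.Binary.Definitions using (tri<; tri≈; tri>)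
open import Relation.Binary.Properties.DecTotalOrder ≤-decTotalOrder using (≥-decTotalOrder)
open import Relation.Binary.Bundles using (DecTotalOrder)
open import Relation.Binary.PropositionalEquality
open import Relation.Nullary using (Dec; yes; no; does; ¬_)
open import Relation.Nullary.Decidable using (_×-dec_)
open import Relation.Unary using (Pred; Decidable)
open import Level using (0ℓ)

-- Finite sums and products over lists, treated uniformly.

module BigOp {_∙_ : Op₂ ℕ} {ε : ℕ} (isCM : IsCommutativeMonoid _≡_ _∙_ ε) where
  open IsCommutativeMonoid isCM hiding (refl; sym; trans; ∙-cong)

  private
    commutativeSemigroup : CommutativeSemigroup 0ℓ 0ℓ
    commutativeSemigroup = record { isCommutativeSemigroup = isCommutativeSemigroup }

  open CommutativeSemigroupProperties commutativeSemigroup using (interchange)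
  open ≡-Reasoning

  ⨀ : {A : Set} → List A → (A → ℕ) → ℕ
  ⨀ xs f = foldr _∙_ ε (map f xs)

  -- The neutral default lets an operation over a filtered list run over the whole list, which is
  -- what makes exchanging the order of two operations possible.
  when : {P : Set} → Dec P → ℕ → ℕ
  when p? c = if does p? then c else ε

  module _ {A : Set} where

    ⨀-cong : ∀ {f g : A → ℕ} → (∀ x → f x ≡ g x) → ∀ xs → ⨀ xs f ≡ ⨀ xs g
    ⨀-cong f≗g []       = refl
    ⨀-cong f≗g (x ∷ xs) = cong₂ _∙_ (f≗g x) (⨀-cong f≗g xs)

    ⨀-∙ : ∀ (f g : A → ℕ) xs → ⨀ xs (λ x → f x ∙ g x) ≡ ⨀ xs f ∙ ⨀ xs g
    ⨀-∙ f g []       = sym (identityˡ ε)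
    ⨀-∙ f g (x ∷ xs) = begin
      (f x ∙ g x) ∙ ⨀ xs (λ x → f x ∙ g x)  ≡⟨ cong ((f x ∙ g x) ∙_) (⨀-∙ f g xs) ⟩
      (f x ∙ g x) ∙ (⨀ xs f ∙ ⨀ xs g)       ≡⟨ interchange (f x) (g x) (⨀ xs f) (⨀ xs g) ⟩
      (f x ∙ ⨀ xs f) ∙ (g x ∙ ⨀ xs g)       ∎

    ⨀-ε : ∀ (xs : List A) → ⨀ xs (const ε) ≡ ε
    ⨀-ε []       = refl
    ⨀-ε (x ∷ xs) = trans (identityˡ _) (⨀-ε xs)

    ⨀-++ : ∀ (f : A → ℕ) xs ys → ⨀ (xs ++ ys) f ≡ ⨀ xs f ∙ ⨀ ys f
    ⨀-++ f []       ys = sym (identityˡ _)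
    ⨀-++ f (x ∷ xs) ys = trans (cong (f x ∙_) (⨀-++ f xs ys)) (sym (assoc _ _ _))

    ⨀-filter : ∀ {P : Pred A 0ℓ} (P? : Decidable P) f xs →
               ⨀ (filter P? xs) f ≡ ⨀ xs (λ x → when (P? x) (f x))
    ⨀-filter P? f [] = refl
    ⨀-filter P? f (x ∷ xs) with P? x
    ... | yes _ = cong (f x ∙_) (⨀-filter P? f xs)
    ... | no  _ = trans (⨀-filter P? f xs) (sym (identityˡ _))

  module _ {A B : Set} where

    ⨀-swap : ∀ (f : A → B → ℕ) xs ys →
             ⨀ xs (λ x → ⨀ ys (f x)) ≡ ⨀ ys (λ y → ⨀ xs (λ x → f x y))
    ⨀-swap f []       ys = sym (⨀-ε ys)
    ⨀-swap f (x ∷ xs) ys =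
      trans (cong (⨀ ys (f x) ∙_) (⨀-swap f xs ys)) (sym (⨀-∙ _ _ ys))

    ⨀-cartesianProduct : ∀ (f : A × B → ℕ) xs ys →
      ⨀ (cartesianProduct xs ys) f ≡ ⨀ xs (λ x → ⨀ ys (λ y → f (x , y)))
    ⨀-cartesianProduct f []       ys = refl
    ⨀-cartesianProduct f (x ∷ xs) ys = begin
      ⨀ (map (x ,_) ys ++ cartesianProduct xs ys) f
        ≡⟨ ⨀-++ f (map (x ,_) ys) _ ⟩
      ⨀ (map (x ,_) ys) f ∙ ⨀ (cartesianProduct xs ys) f
        ≡⟨ cong₂ _∙_ (cong (foldr _∙_ ε) (sym (map-∘ ys))) (⨀-cartesianProduct f xs ys) ⟩
      ⨀ ys (λ y → f (x , y)) ∙ ⨀ xs (λ x → ⨀ ys (λ y → f (x , y))) ∎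

module Σ = BigOp +-0-isCommutativeMonoid
module Π = BigOp *-1-isCommutativeMonoid

module _ {A : Set} where

  sum-map-1 : ∀ (xs : List A) → Σ.⨀ xs (const 1) ≡ length xs
  sum-map-1 []       = refl
  sum-map-1 (x ∷ xs) = cong suc (sum-map-1 xs)

  product-map-const : ∀ c (xs : List A) → Π.⨀ xs (const c) ≡ c ^ length xs
  product-map-const c []       = refl
  product-map-const c (x ∷ xs) = cong (c *_) (product-map-const c xs)

  product-map-^ : ∀ c (f : A → ℕ) xs → Π.⨀ xs (λ x → c ^ f x) ≡ c ^ Σ.⨀ xs f
  product-map-^ c f []       = refl
  product-map-^ c f (x ∷ xs) =
    trans (cong (c ^ f x *_) (product-map-^ c f xs)) (sym (^-distribˡ-+-* c (f x) _))

  length-filter-Σ : ∀ {P : Pred A 0ℓ} (P? : Decidable P) xs →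
    length (filter P? xs) ≡ Σ.⨀ xs (λ x → Σ.when (P? x) 1)
  length-filter-Σ P? xs =
    trans (sym (sum-map-1 (filter P? xs))) (Σ.⨀-filter P? (const 1) xs)

  product-when : ∀ {P : Pred A 0ℓ} (P? : Decidable P) c xs →
    Π.⨀ xs (λ x → Π.when (P? x) c) ≡ c ^ length (filter P? xs)
  product-when P? c xs =
    trans (sym (Π.⨀-filter P? (const c) xs)) (product-map-const c (filter P? xs))

  term≤sum : ∀ (f : A → ℕ) {x xs} → x ∈ xs → f x ≤ Σ.⨀ xs f
  term≤sum f (here refl) = m≤m+n _ _
  term≤sum f (there x∈)  = ≤-trans (term≤sum f x∈) (m≤n+m _ _)

  sum-mono-≤ : ∀ {f g : A → ℕ} → (∀ x → f x ≤ g x) → ∀ xs → Σ.⨀ xs f ≤ Σ.⨀ xs g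
  sum-mono-≤ f≤g []       = z≤n
  sum-mono-≤ f≤g (x ∷ xs) = +-mono-≤ (f≤g x) (sum-mono-≤ f≤g xs)

  product-mono-≤ : ∀ {f g : A → ℕ} → (∀ x → f x ≤ g x) → ∀ xs → Π.⨀ xs f ≤ Π.⨀ xs g
  product-mono-≤ f≤g []       = ≤-refl
  product-mono-≤ f≤g (x ∷ xs) = *-mono-≤ (f≤g x) (product-mono-≤ f≤g xs)

  product>0 : ∀ {f : A → ℕ} → (∀ x → 0 < f x) → ∀ xs → 0 < Π.⨀ xs f
  product>0 f>0 []       = ≤-refl
  product>0 f>0 (x ∷ xs) = *-mono-≤ (f>0 x) (product>0 f>0 xs)

  -- From `f y * F ≤ g y * F ≤ g y * G ≤ f y * F` the positive factor `F` cancels to compare the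
  -- heads, and in the same way `f y` cancels to compare the tails.
  product-squeeze : ∀ {f g : A → ℕ} → (∀ x → 0 < f x) → (∀ x → f x ≤ g x) →
    ∀ xs → Π.⨀ xs g ≤ Π.⨀ xs f → ∀ {x} → x ∈ xs → f x ≡ g x
  product-squeeze {f} {g} f>0 f≤g (y ∷ ys) G≤F = λ where
      (here refl) → fy≡gy
      (there x∈)  → product-squeeze f>0 f≤g ys Gys≤Fys x∈
    where
    F G : ℕ
    F = Π.⨀ ys f
    G = Π.⨀ ys g
    instance
      F≢0 : NonZero F
      F≢0 = >-nonZero (product>0 f>0 ys)
      fy≢0 : NonZero (f y)
      fy≢0 = >-nonZero (f>0 y)
    fy≡gy : f y ≡ g y
    fy≡gy = ≤-antisym (f≤g y) (*-cancelʳ-≤ (g y) (f y) F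
      (≤-trans (*-monoʳ-≤ (g y) (product-mono-≤ f≤g ys)) G≤F))
    Gys≤Fys : G ≤ F
    Gys≤Fys = *-cancelˡ-≤ (f y) (≤-trans (*-monoˡ-≤ G (f≤g y)) G≤F)

∈⇒≤foldr-⊔ : ∀ {x xs} → x ∈ xs → x ≤ foldr _⊔_ 0 xs
∈⇒≤foldr-⊔ (here refl) = m≤m⊔n _ _
∈⇒≤foldr-⊔ (there x∈)  = ≤-trans (∈⇒≤foldr-⊔ x∈) (m≤n⊔m _ _)

-- Chord inequalities for dᵈ at a single degree.

-- From degree 4 on, `4 ^ d ≤ d ^ d` holds by monotonicity of the base, so every constant above 1
-- gives strictness.
4^d<c*d^d : ∀ c → 1 < c → ∀ d → 4 ≤ d → 4 ^ d < c * d ^ d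
4^d<c*d^d c 1<c d 4≤d = <-≤-trans
  (m<m*n (4 ^ d) c ⦃ m^n≢0 4 d ⦄ 1<c)
  (≤-trans (≤-reflexive (*-comm (4 ^ d) c)) (*-monoʳ-≤ c (^-monoˡ-≤ d 4≤d)))

4^d≤4*d^d : ∀ d → 4 ^ d ≤ 4 * d ^ d
4^d≤4*d^d 0 = s≤s z≤n
4^d≤4*d^d 1 = ≤-refl
4^d≤4*d^d 2 = ≤-refl
4^d≤4*d^d 3 = ≤ᵇ⇒≤ _ _ _
4^d≤4*d^d d@(suc (suc (suc (suc _)))) = <⇒≤ (4^d<c*d^d 4 (s≤s (s≤s z≤n)) d (s≤s (s≤s (s≤s (s≤s z≤n)))))

-- The degrees 0 and 3 are refuted by evaluation: the equation would read 1 ≡ 4 or 64 ≡ 108.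
4^d≡4*d^d⇒ : ∀ d → 4 ^ d ≡ 4 * d ^ d → d ≡ 1 ⊎ d ≡ 2
4^d≡4*d^d⇒ 1 _ = inj₁ refl
4^d≡4*d^d⇒ 2 _ = inj₂ refl
4^d≡4*d^d⇒ d@(suc (suc (suc (suc _)))) eq =
  ⊥-elim (<⇒≢ (4^d<c*d^d 4 (s≤s (s≤s z≤n)) d (s≤s (s≤s (s≤s (s≤s z≤n))))) eq)

27*4^d<64*d^d : ∀ d → 4 ≤ d → 27 * 4 ^ d < 64 * d ^ d
27*4^d<64*d^d d 4≤d = <-≤-trans
  -- The constant 2 suffices here because 27 · 2 = 54 ≤ 64.
  (*-monoʳ-< 27 (4^d<c*d^d 2 ≤-refl d 4≤d))
  (≤-trans (≤-reflexive (sym (*-assoc 27 2 (d ^ d)))) (*-monoˡ-≤ (d ^ d) (≤ᵇ⇒≤ 54 64 _)))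

27*4^d≤64*d^d : ∀ d → 3 ≤ d → 27 * 4 ^ d ≤ 64 * d ^ d
27*4^d≤64*d^d d 3≤d with m≤n⇒m<n∨m≡n 3≤d
... | inj₁ 4≤d  = <⇒≤ (27*4^d<64*d^d d 4≤d)
... | inj₂ refl = ≤-refl

27*4^d≡64*d^d⇒ : ∀ d → 3 ≤ d → 27 * 4 ^ d ≡ 64 * d ^ d → d ≡ 3
27*4^d≡64*d^d⇒ d 3≤d eq with m≤n⇒m<n∨m≡n 3≤d
... | inj₁ 4≤d  = ⊥-elim (<⇒≢ (27*4^d<64*d^d d 4≤d) eq)
... | inj₂ refl = refl

module _ {P : Set} (p? : Dec P) (e : ℕ) where

  -- With `p?` deciding whether a vertex of degree `e` has maximum degree, these are the two sides
  -- of its chord inequality, cleared of denominators: `27 * 4 ^ e` against `64 * e ^ e` if it has,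
  -- `4 ^ e` against `4 * e ^ e` if not. Writing 64 as 4 · 16 leaves one factor 4 at every vertex.
  lowerFactor upperFactor : ℕ
  lowerFactor = Π.when p? 27 * 4 ^ e
  upperFactor = 4 * Π.when p? 16 * e ^ e

lowerFactor>0 : ∀ {P} (p? : Dec P) e → 0 < lowerFactor p? e
lowerFactor>0 (yes _) e = *-mono-≤ {1} {27} (s≤s z≤n) (m^n>0 4 e)
lowerFactor>0 (no  _) e = *-mono-≤ {1} {1} (s≤s z≤n) (m^n>0 4 e)

lowerFactor≤upperFactor : ∀ {P} (p? : Dec P) e → (P → 3 ≤ e) → lowerFactor p? e ≤ upperFactor p? e
lowerFactor≤upperFactor (yes p) e 3≤e = 27*4^d≤64*d^d e (3≤e p)
lowerFactor≤upperFactor (no  _) e _   = ≤-trans (≤-reflexive (*-identityˡ _)) (4^d≤4*d^d e)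

factors≡⇒≡3 : ∀ {P} (p? : Dec P) e → lowerFactor p? e ≡ upperFactor p? e → P → 3 ≤ e → e ≡ 3
factors≡⇒≡3 (yes _) e eq _ 3≤e = 27*4^d≡64*d^d⇒ e 3≤e eq
factors≡⇒≡3 (no ¬p) e _  p _   = ⊥-elim (¬p p)

factors≡⇒≡1⊎≡2 : ∀ {P} (p? : Dec P) e → lowerFactor p? e ≡ upperFactor p? e → ¬ P → e ≡ 1 ⊎ e ≡ 2
factors≡⇒≡1⊎≡2 (yes p) e _  ¬p = ⊥-elim (¬p p)
factors≡⇒≡1⊎≡2 (no  _) e eq _  = 4^d≡4*d^d⇒ e (trans (sym (*-identityˡ _)) eq)

-- The second Zagreb index as a product over vertices.

module _ {n : ℕ} (G : Graph n) where
  open Graph G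

  open DecMembership (Fin._≟_ {n}) using (_∈?_)

  private
    V : List (Fin n)
    V = allFin n

    d : Fin n → ℕ
    d = degree G

  -- `E` and `E′` are adjacency in the two directions, `P` and `Q` the two strict orders of the
  -- endpoints. An edge is listed in exactly one orientation, so exactly one of the two factors is
  -- `c`.
  when-split : ∀ {P Q E E′ : Set} (p : Dec P) (q : Dec Q) (e : Dec E) (e′ : Dec E′) c →
    (E → E′) → (E′ → E) → (E → P ⊎ Q) → ¬ (P × Q) →
    Π.when (p ×-dec e) c * Π.when (q ×-dec e′) c ≡ Π.when e c
  when-split p       q       (no ¬e) (yes e′) c _  g _ _   = ⊥-elim (¬e (g e′))
  when-split p       q       (yes e) (no ¬e′) c f  _ _ _   = ⊥-elim (¬e′ (f e))
  when-split (yes p) (yes q) (yes _) (yes _)  c _  _ _ ¬pq = ⊥-elim (¬pq (p , q))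
  when-split (no ¬p) (no ¬q) (yes e) (yes _)  c _  _ h _   = ⊥-elim ([ ¬p , ¬q ]′ (h e))
  when-split (yes _) (no  _) (yes _) (yes _)  c _  _ _ _   = *-identityʳ c
  when-split (no  _) (yes _) (yes _) (yes _)  c _  _ _ _   = *-identityˡ c
  when-split (yes _) (yes _) (no  _) (no  _)  c _  _ _ _   = refl
  when-split (yes _) (no  _) (no  _) (no  _)  c _  _ _ _   = refl
  when-split (no  _) (yes _) (no  _) (no  _)  c _  _ _ _   = refl
  when-split (no  _) (no  _) (no  _) (no  _)  c _  _ _ _   = refl

  -- The factor `d u * d v` of an edge is shared out to its endpoints. Each vertex `u` then receives
  -- `d u` once from every neighbour, hence `d u` times.
  Π₂≡∏d^d : Π₂ G ≡ Π.⨀ V (λ u → d u ^ d u)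
  Π₂≡∏d^d = begin
    Π.⨀ (edges G) (λ (u , v) → d u * d v)
      ≡⟨ Π.⨀-filter _ _ (cartesianProduct V V) ⟩
    Π.⨀ (cartesianProduct V V) (λ (u , v) → Π.when (edge? u v) (d u * d v))
      ≡⟨ Π.⨀-cartesianProduct _ V V ⟩
    Π.⨀ V (λ u → Π.⨀ V (λ v → Π.when (edge? u v) (d u * d v)))
      ≡⟨ Π.⨀-cong (λ u → trans (Π.⨀-cong (λ v → when-* (edge? u v) (d u) (d v)) V) (Π.⨀-∙ _ _ V)) V ⟩
    Π.⨀ V (λ u → Π.⨀ V (λ v → Π.when (edge? u v) (d u)) * Π.⨀ V (λ v → Π.when (edge? u v) (d v)))
      ≡⟨ Π.⨀-∙ _ _ V ⟩
    Π.⨀ V (λ u → Π.⨀ V (λ v → Π.when (edge? u v) (d u)))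
      * Π.⨀ V (λ u → Π.⨀ V (λ v → Π.when (edge? u v) (d v)))
      -- Exchanging the order of multiplication in the second factor credits the larger endpoint of
      -- each edge, so that both factors become products over the credited vertex.
      ≡⟨ cong (Π.⨀ V (λ u → Π.⨀ V (λ v → Π.when (edge? u v) (d u))) *_)
           (Π.⨀-swap (λ u v → Π.when (edge? u v) (d v)) V V) ⟩
    Π.⨀ V (λ u → Π.⨀ V (λ v → Π.when (edge? u v) (d u)))
      * Π.⨀ V (λ u → Π.⨀ V (λ v → Π.when (edge? v u) (d u)))
      ≡⟨ Π.⨀-∙ _ _ V ⟨
    Π.⨀ V (λ u → Π.⨀ V (λ v → Π.when (edge? u v) (d u)) * Π.⨀ V (λ v → Π.when (edge? v u) (d u)))
      ≡⟨ Π.⨀-cong (λ u → trans (sym (Π.⨀-∙ _ _ V)) (Π.⨀-cong (recombine u) V)) V ⟩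
    Π.⨀ V (λ u → Π.⨀ V (λ v → Π.when (u ~? v) (d u)))
      ≡⟨ Π.⨀-cong (λ u → product-when (u ~?_) (d u) V) V ⟩
    Π.⨀ V (λ u → d u ^ d u) ∎
    where
    open ≡-Reasoning
    edge? : ∀ u v → Dec _
    edge? u v = (u Fin.<? v) ×-dec (u ~? v)
    when-* : ∀ {P : Set} (p? : Dec P) a b → Π.when p? (a * b) ≡ Π.when p? a * Π.when p? b
    when-* (yes _) a b = refl
    when-* (no  _) a b = refl
    distinct : ∀ {u v} → u ~ v → u Fin.< v ⊎ v Fin.< u
    distinct {u} {v} u~v with Fin.<-cmp u v
    ... | tri< u<v _ _ = inj₁ u<v
    ... | tri≈ _ u≡v _ = ⊥-elim (irrefl u≡v u~v)
    ... | tri> _ _ v<u = inj₂ v<u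
    recombine : ∀ u v → Π.when (edge? u v) (d u) * Π.when (edge? v u) (d u) ≡ Π.when (u ~? v) (d u)
    recombine u v = when-split (u Fin.<? v) (v Fin.<? u) (u ~? v) (v ~? u) (d u)
      symm symm distinct (λ (p , q) → <-asym p q)

  -- The degree sum of a connected graph.

  private
    adj : Fin n → Fin n → ℕ
    adj u v = Σ.when (u ~? v) 1

    adj≡1 : ∀ {u v} → u ~ v → adj u v ≡ 1
    adj≡1 {u} {v} u~v with u ~? v
    ... | yes _   = refl
    ... | no  u≁v = ⊥-elim (u≁v u~v)

    -- Twice the number of edges of the subgraph induced on S.
    degreeSumOn : List (Fin n) → ℕ
    degreeSumOn S = Σ.⨀ S (λ u → Σ.⨀ S (adj u))

    degreeSumOn-↭ : ∀ {S R} → S ↭ R → degreeSumOn S ≡ degreeSumOn R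
    degreeSumOn-↭ {S} {R} S↭R = trans
      (Σ.⨀-cong (λ u → sum-↭ (map⁺ (adj u) S↭R)) S)
      (sum-↭ (map⁺ (λ u → Σ.⨀ R (adj u)) S↭R))

    -- The edge between `x` and `y` contributes once to the row of `x` and once to its column in the
    -- adjacency matrix; all other new entries are estimated by 0.
    degreeSumOn-∷ : ∀ {x y S} → y ∈ S → y ~ x → 2 + degreeSumOn S ≤ degreeSumOn (x ∷ S)
    degreeSumOn-∷ {x} {y} {S} y∈S y~x = begin
      1 + (1 + degreeSumOn S)
        ≡⟨ cong₂ (λ a b → a + (b + degreeSumOn S)) (adj≡1 (symm y~x)) (adj≡1 y~x) ⟨
      adj x y + (adj y x + degreeSumOn S)
        ≤⟨ +-mono-≤ (term≤sum (adj x) y∈S) (+-monoˡ-≤ _ (term≤sum (λ u → adj u x) y∈S)) ⟩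
      Σ.⨀ S (adj x) + (Σ.⨀ S (λ u → adj u x) + degreeSumOn S)
        ≡⟨ cong (λ z → Σ.⨀ S (adj x) + z) (Σ.⨀-∙ _ _ S) ⟨
      Σ.⨀ S (adj x) + Σ.⨀ S (λ u → Σ.⨀ (x ∷ S) (adj u))
        ≤⟨ +-monoˡ-≤ _ (m≤n+m _ (adj x x)) ⟩
      degreeSumOn (x ∷ S) ∎
      where open ≤-Reasoning

  -- The path starts outside `R` and ends in it; the edge is its first step into `R`.
  crossing-edge : ∀ {S R s r} → (∀ v → v ∈ S ⊎ v ∈ R) → Star _~_ s r → ¬ s ∈ R → r ∈ R →
    ∃₂ λ y x → y ∈ S × x ∈ R × y ~ x
  crossing-edge cover ε s∉R r∈R = ⊥-elim (s∉R r∈R)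
  crossing-edge {R = R} {s = s} cover (_◅_ {j = t} s~t path) s∉R r∈R with t ∈? R | cover s
  ... | yes t∈R | inj₁ s∈S = s , t , s∈S , t∈R , s~t
  ... | yes t∈R | inj₂ s∈R = ⊥-elim (s∉R s∈R)
  ... | no  t∉R | _        = crossing-edge cover path t∉R r∈R

  -- The vertices are enumerated so that each one after s is adjacent to an earlier
  -- one: S is the part enumerated so far and R the rest.
  grow : Connected G → ∀ s k S R → length R ≡ k → S ++ R ↭ V → ¬ s ∈ R →
         2 * length S ≤ 2 + degreeSumOn S → 2 * n ≤ 2 + degreeSumOn V
  grow conn s k S [] _ S↭V _ inv = begin
    2 * n               ≡⟨ cong (2 *_) (length-tabulate {n = n} (λ v → v)) ⟨
    2 * length V        ≡⟨ cong (2 *_) (↭-length S↭V′) ⟨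
    2 * length S        ≤⟨ inv ⟩
    2 + degreeSumOn S   ≡⟨ cong (λ z → 2 + z) (degreeSumOn-↭ S↭V′) ⟩
    2 + degreeSumOn V   ∎
    where
    open ≤-Reasoning
    S↭V′ : S ↭ V
    S↭V′ = subst (_↭ V) (++-identityʳ S) S↭V
  -- The recursion is on the length `k` of `R`, because the vertex `x` moved to `S` may stand
  -- anywhere in `R`.
  grow conn s (suc k) S R@(r ∷ _) |R|≡ S++R↭V s∉R inv
    with y , x , y∈S , x∈R , y~x ← crossing-edge
           (λ v → ∈-++⁻ S (∈-resp-↭ (↭-sym S++R↭V) (∈-allFin v))) (conn s r) s∉R (here refl)
    with as , bs , R≡ ← ∈-∃++ x∈R =
    grow conn s k (x ∷ S) (as ++ bs)
      (suc-injective (trans (sym (↭-length R↭)) |R|≡))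
      (↭-trans (↭-sym (shift x S (as ++ bs))) (↭-trans (++⁺ˡ S (↭-sym R↭)) S++R↭V))
      (λ s∈ → s∉R (∈-resp-↭ (↭-sym R↭) (there s∈)))
      (begin
        2 * suc (length S)         ≡⟨ *-suc 2 (length S) ⟩
        2 + 2 * length S           ≤⟨ +-monoʳ-≤ 2 inv ⟩
        2 + (2 + degreeSumOn S)    ≤⟨ +-monoʳ-≤ 2 (degreeSumOn-∷ y∈S y~x) ⟩
        2 + degreeSumOn (x ∷ S)    ∎)
    where
    open ≤-Reasoning
    R↭ : R ↭ x ∷ as ++ bs
    R↭ = ↭-trans (↭-reflexive R≡) (shift x as bs)

  sum-degrees≡ : Σ.⨀ V d ≡ degreeSumOn V
  sum-degrees≡ = Σ.⨀-cong (λ u → length-filter-Σ (u ~?_) V) V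

zero∉tabulate-suc : ∀ {n} → ¬ zero ∈ tabulate {n = n} Fin.suc
zero∉tabulate-suc 0∈ with ∈-tabulate⁻ 0∈
... | _ , ()

-- This is the bound of at least n - 1 edges, doubled and freed of subtraction.
connected⇒2n≤2+sum-degrees : ∀ {n} (G : Graph n) → Connected G →
  2 * n ≤ 2 + Σ.⨀ (allFin n) (degree G)
connected⇒2n≤2+sum-degrees {zero}  G conn = z≤n
connected⇒2n≤2+sum-degrees {suc n} G conn =
  -- The enumeration starts with the single vertex `zero`, where the invariant only asks for 2 ≤ 2 +
  -- _.
  ≤-trans (grow G conn zero _ (zero ∷ []) (tabulate suc) refl ↭-refl zero∉tabulate-suc (m≤m+n 2 _))
    (≤-reflexive (cong (λ z → 2 + z) (sym (sum-degrees≡ G))))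

-- The extremal degree sequence.

-- All three lengths are free, since the equality case first reaches this shape with unknown `b` and
-- `c` and determines them afterwards.
descending : ℕ → ℕ → ℕ → List ℕ
descending a b c = replicate a 3 ++ replicate b 2 ++ replicate c 1

length-descending : ∀ a b c → length (descending a b c) ≡ a + (b + c)
length-descending a b c
  rewrite length-++ (replicate a 3) {replicate b 2 ++ replicate c 1}
        | length-++ (replicate b 2) {replicate c 1}
        | length-replicate a {3} | length-replicate b {2} | length-replicate c {1} = refl

sum-replicate : ∀ m x → sum (replicate m x) ≡ m * x
sum-replicate zero    x = refl
sum-replicate (suc m) x = cong (λ z → x + z) (sum-replicate m x)

product-replicate : ∀ m x → product (replicate m x) ≡ x ^ m
product-replicate zero    x = refl
product-replicate (suc m) x = cong (x *_) (product-replicate m x)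

sum-descending : ∀ a b c → sum (descending a b c) ≡ a * 3 + (b * 2 + c * 1)
sum-descending a b c
  rewrite sum-++ (replicate a 3) (replicate b 2 ++ replicate c 1)
        | sum-++ (replicate b 2) (replicate c 1)
        | sum-replicate a 3 | sum-replicate b 2 | sum-replicate c 1 = refl

product-descending : ∀ a b c → Π.⨀ (descending a b c) (λ e → e ^ e) ≡ 27 ^ a * 4 ^ b
product-descending a b c = begin
  Π.⨀ (descending a b c) self
    ≡⟨ Π.⨀-++ self (replicate a 3) _ ⟩
  Π.⨀ (replicate a 3) self * Π.⨀ (replicate b 2 ++ replicate c 1) self
    ≡⟨ cong (Π.⨀ (replicate a 3) self *_) (Π.⨀-++ self (replicate b 2) _) ⟩
  Π.⨀ (replicate a 3) self * (Π.⨀ (replicate b 2) self * Π.⨀ (replicate c 1) self)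
    ≡⟨ cong₂ _*_ (power a 3) (cong₂ _*_ (power b 2) (power c 1)) ⟩
  27 ^ a * (4 ^ b * 1 ^ c)
    ≡⟨ cong (λ z → 27 ^ a * (4 ^ b * z)) (^-zeroˡ c) ⟩
  27 ^ a * (4 ^ b * 1)
    ≡⟨ cong (27 ^ a *_) (*-identityʳ (4 ^ b)) ⟩
  27 ^ a * 4 ^ b ∎
  where
  open ≡-Reasoning
  self : ℕ → ℕ
  self e = e ^ e
  power : ∀ m x → Π.⨀ (replicate m x) self ≡ self x ^ m
  power m x = trans (cong product (map-replicate self m x)) (product-replicate m (self x))

AllPairs-replicate-++ : ∀ k {x ys} → All (x ≥_) ys → AllPairs _≥_ ys →
  AllPairs _≥_ (replicate k x ++ ys)
AllPairs-replicate-++ zero    x≥ys ys↘ = ys↘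
AllPairs-replicate-++ (suc k) x≥ys ys↘ =
  All.++⁺ (All.replicate⁺ k ≤-refl) x≥ys ∷ AllPairs-replicate-++ k x≥ys ys↘

descending-↘ : ∀ a b c → AllPairs _≥_ (descending a b c)
descending-↘ a b c =
  AllPairs-replicate-++ a
    (All.++⁺ (All.replicate⁺ b (n≤1+n 2)) (All.replicate⁺ c (s≤s z≤n)))
    (AllPairs-replicate-++ b (All.replicate⁺ c (n≤1+n 1))
      (subst (AllPairs _≥_) (++-identityʳ (replicate c 1)) (AllPairs-replicate-++ c [] [])))

-- Two sorted lists that are permutations of each other coincide, so the equality case can be argued
-- up to permutation.
degreeSequence≡⇔↭ : ∀ {n} (G : Graph n) {xs} → AllPairs _≥_ xs →
  degreeSequence G ≡ xs ⇔ (degrees G ↭ xs)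
degreeSequence≡⇔↭ G {xs} xs↘ = mk⇔
  (λ seq≡ → ↭-trans (↭-sym (sort-↭ (degrees G))) (↭-reflexive seq≡))
  (λ degs↭ → Pointwise-≡⇒≡ (↗↭↗⇒≋ totalOrder (sort-↗ (degrees G)) (AllPairs⇒Sorted totalOrder xs↘)
    (↭⇒↭ₛ (↭-trans (sort-↭ (degrees G)) degs↭))))
  where
  open Sort ≥-decTotalOrder using (sort-↭; sort-↗)
  open DecTotalOrder ≥-decTotalOrder using (totalOrder)

module _ {A : Set} {P : Pred A 0ℓ} (P? : Decidable P) (f : A → ℕ) where

  -- By induction each new value is moved to its block: a 3 stays in front, a 2 passes the threes, a
  -- 1 passes the threes and the twos.
  ↭-descending : ∀ xs → (∀ {x} → x ∈ xs → P x → f x ≡ 3) →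
    (∀ {x} → x ∈ xs → ¬ P x → f x ≡ 1 ⊎ f x ≡ 2) →
    ∃₂ λ b c → map f xs ↭ descending (length (filter P? xs)) b c
  ↭-descending [] _ _ = 0 , 0 , ↭-refl
  ↭-descending (x ∷ xs) three other
    with b , c , xs↭ ← ↭-descending xs (three ∘ there) (other ∘ there)
    with P? x
  ... | yes px rewrite three (here refl) px = b , c , prep 3 xs↭
  ... | no ¬px with other (here refl) ¬px
  ...   | inj₁ fx≡1 rewrite fx≡1 = b , suc c ,
          ↭-trans (prep 1 xs↭) (↭-trans
            (prep 1 (↭-reflexive (sym (++-assoc threes twos _))))
            (↭-trans (↭-sym (shift 1 (threes ++ twos) (replicate c 1)))
              (↭-reflexive (++-assoc threes twos _))))
    where
    threes twos : List ℕ
    threes = replicate (length (filter P? xs)) 3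
    twos   = replicate b 2
  ...   | inj₂ fx≡2 rewrite fx≡2 = suc b , c ,
          ↭-trans (prep 2 xs↭) (↭-sym (shift 2 (replicate (length (filter P? xs)) 3) _))

-- The bound rewritten over the rationals.

ι : ℕ → ℚ
ι a = + a / 1

-- The operation `/` normalises its fraction, so the comparison is made among unnormalised
-- rationals, where denominators 1 simply multiply.
ι-* : ∀ a b → ι (a * b) ≡ ι a *ℚ ι b
ι-* a b = ℚ.toℚᵘ-injective (begin
  toℚᵘ (ι (a * b))          ≈⟨ ℚ.toℚᵘ-fromℚᵘ (mkℚᵘ (+ (a * b)) 0) ⟩
  mkℚᵘ (+ (a * b)) 0        ≡⟨ cong (λ z → mkℚᵘ z 0) (pos-* a b) ⟩
  mkℚᵘ (+ a) 0 *ℚᵘ mkℚᵘ (+ b) 0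
    ≈⟨ ℚᵘ.*-cong (ℚ.toℚᵘ-fromℚᵘ (mkℚᵘ (+ a) 0)) (ℚ.toℚᵘ-fromℚᵘ (mkℚᵘ (+ b) 0)) ⟨
  toℚᵘ (ι a) *ℚᵘ toℚᵘ (ι b)  ≈⟨ ℚ.toℚᵘ-homo-* (ι a) (ι b) ⟨
  toℚᵘ (ι a *ℚ ι b)         ∎)
  where
  open ℚᵘ.≃-Reasoning

ι-^ : ∀ a e → ι (a ^ e) ≡ ι a ^ℚ e
ι-^ a zero    = refl
ι-^ a (suc e) = trans (ι-* a (a ^ e)) (cong (ι a *ℚ_) (ι-^ a e))

rational-form : ∀ k m → ι (27 ^ k * 4 ^ m) ≡ (+ 27 / 16) ^ℚ k *ℚ ι 4 ^ℚ (2 * k + m)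
rational-form k m = begin
  ι (27 ^ k * 4 ^ m)                         ≡⟨ ι-* (27 ^ k) (4 ^ m) ⟩
  ι (27 ^ k) *ℚ ι (4 ^ m)                    ≡⟨ cong₂ _*ℚ_ (ι-^ 27 k) (ι-^ 4 m) ⟩
  -- By evaluation `ι 27` is `q *ℚ ι 4 ^ℚ 2`, as 27 = (27/16) · 4².
  (q *ℚ ι 4 ^ℚ 2) ^ℚ k *ℚ ι 4 ^ℚ m            ≡⟨ cong (_*ℚ ι 4 ^ℚ m) (^-distrib-* q (ι 4 ^ℚ 2) k) ⟩
  (q ^ℚ k *ℚ (ι 4 ^ℚ 2) ^ℚ k) *ℚ ι 4 ^ℚ m     ≡⟨ ℚ.*-assoc (q ^ℚ k) _ _ ⟩
  q ^ℚ k *ℚ ((ι 4 ^ℚ 2) ^ℚ k *ℚ ι 4 ^ℚ m)     ≡⟨ cong (λ z → q ^ℚ k *ℚ (z *ℚ ι 4 ^ℚ m)) (^-assocʳ (ι 4) 2 k) ⟩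
  q ^ℚ k *ℚ (ι 4 ^ℚ (2 * k) *ℚ ι 4 ^ℚ m)      ≡⟨ cong (q ^ℚ k *ℚ_) (^-homo-* (ι 4) (2 * k) m) ⟨
  q ^ℚ k *ℚ ι 4 ^ℚ (2 * k + m)               ∎
  where
  open ≡-Reasoning
  open CommutativeRing ℚ.+-*-commutativeRing using (semiring; commutativeSemiring)
  open Exp semiring using (^-homo-*; ^-assocʳ)
  open CommutativeExp commutativeSemiring using (^-distrib-*)
  q : ℚ
  q = + 27 / 16

-- The bound and its equality case, with m = n - 2k - 2.

module _ {n k m : ℕ} (n≡ : n ≡ 2 * k + 2 + m) (1≤k : 1 ≤ k) (G : Graph n)
  (connected : Connected G)
  (#max≡k : length (filter (λ v → degree G v ≟ maxDegree G) (allFin n)) ≡ k) where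

  private
    V : List (Fin n)
    V = allFin n

    d : Fin n → ℕ
    d = degree G

    S : ℕ
    S = Σ.⨀ V d

    max? : ∀ v → Dec (d v ≡ maxDegree G)
    max? v = d v ≟ maxDegree G

    |V|≡n : length V ≡ n
    |V|≡n = length-tabulate (λ v → v)

    d≤max : ∀ v → d v ≤ maxDegree G
    d≤max v = ∈⇒≤foldr-⊔ (∈-map⁺ d (∈-allFin v))

    2n≤2+S : 2 * n ≤ 2 + S
    2n≤2+S = connected⇒2n≤2+sum-degrees G connected

    -- Every vertex below the maximum then has degree at most 1, and each of the k others exceeds 1
    -- by at most 1.
    max≤2⇒S≤n+k : maxDegree G ≤ 2 → S ≤ n + k
    max≤2⇒S≤n+k max≤2 = begin
      S                                          ≤⟨ sum-mono-≤ d≤ V ⟩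
      Σ.⨀ V (λ v → 1 + Σ.when (max? v) 1)        ≡⟨ Σ.⨀-∙ _ _ V ⟩
      Σ.⨀ V (const 1) + Σ.⨀ V (λ v → Σ.when (max? v) 1)
        ≡⟨ cong₂ _+_ (trans (sum-map-1 V) |V|≡n) (trans (sym (length-filter-Σ max? V)) #max≡k) ⟩
      n + k ∎
      where
      open ≤-Reasoning
      ≤1+when : ∀ {e} (e≡? : Dec (e ≡ maxDegree G)) → e ≤ maxDegree G → e ≤ 1 + Σ.when e≡? 1
      ≤1+when (yes _)   e≤max = ≤-trans e≤max max≤2
      ≤1+when (no ≢max) e≤max = ≤-pred (≤-trans (≤∧≢⇒< e≤max ≢max) max≤2)
      d≤ : ∀ v → d v ≤ 1 + Σ.when (max? v) 1
      d≤ v = ≤1+when (max? v) (d≤max v)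

    -- Otherwise 2n ≤ 2 + `S` ≤ 2 + n + k, so n ≤ k + 2; with n = 2k + 2 + m this forces k ≤ 0.
    3≤max : 3 ≤ maxDegree G
    3≤max = ≰⇒> λ max≤2 → <⇒≱ 1≤k (+-cancelʳ-≤ (n + k + 2 + m) k 0 (begin
      k + (n + k + 2 + m)      ≡⟨ rearrange n k m ⟩
      n + (2 * k + 2 + m)      ≡⟨ cong (λ z → n + z) n≡ ⟨
      n + n                    ≡⟨ cong (λ z → n + z) (+-identityʳ n) ⟨
      2 * n                    ≤⟨ 2n≤2+S ⟩
      2 + S                    ≤⟨ +-monoʳ-≤ 2 (max≤2⇒S≤n+k max≤2) ⟩
      2 + (n + k)              ≡⟨ +-comm 2 (n + k) ⟩
      n + k + 2                ≤⟨ m≤m+n _ m ⟩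
      n + k + 2 + m            ∎))
      where
      open ≤-Reasoning
      rearrange : ∀ n k m → k + (n + k + 2 + m) ≡ n + (2 * k + 2 + m)
      rearrange = solve-∀

    lower upper : Fin n → ℕ
    lower v = lowerFactor (max? v) (d v)
    upper v = upperFactor (max? v) (d v)

    lower>0 : ∀ v → 0 < lower v
    lower>0 v = lowerFactor>0 (max? v) (d v)

    max⇒3≤d : ∀ v → d v ≡ maxDegree G → 3 ≤ d v
    max⇒3≤d v ≡max = subst (3 ≤_) (sym ≡max) 3≤max

    lower≤upper : ∀ v → lower v ≤ upper v
    lower≤upper v = lowerFactor≤upperFactor (max? v) (d v) (max⇒3≤d v)

    -- The constants of `upper` multiplied together: 4 for each vertex and 16 for each of the k of
    -- maximum degree.
    K : ℕ
    K = 4 ^ n * 16 ^ k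

    instance
      K≢0 : NonZero K
      K≢0 = m*n≢0 _ _ ⦃ m^n≢0 4 n ⦄ ⦃ m^n≢0 16 k ⦄

    product-lower : Π.⨀ V lower ≡ 27 ^ k * 4 ^ S
    product-lower = trans (Π.⨀-∙ _ _ V)
      (cong₂ _*_ (trans (product-when max? 27 V) (cong (27 ^_) #max≡k)) (product-map-^ 4 d V))

    product-upper : Π.⨀ V upper ≡ K * Π₂ G
    product-upper = trans (Π.⨀-∙ _ _ V) (cong₂ _*_
      (trans (Π.⨀-∙ _ _ V) (cong₂ _*_
        (trans (product-map-const 4 V) (cong (4 ^_) |V|≡n))
        (trans (product-when max? 16 V) (cong (16 ^_) #max≡k))))
      (sym (Π₂≡∏d^d G)))

    -- This is 2n - 2, the degree sum of a tree, written without subtraction.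
    S₀ : ℕ
    S₀ = n + 2 * k + m

    2+S₀≡2n : 2 + S₀ ≡ 2 * n
    2+S₀≡2n = trans (rearrange n k m) (cong (λ z → n + z) (trans (sym n≡) (sym (+-identityʳ n))))
      where
      rearrange : ∀ n k m → 2 + (n + 2 * k + m) ≡ n + (2 * k + 2 + m)
      rearrange = solve-∀

    S₀≤S : S₀ ≤ S
    S₀≤S = +-cancelˡ-≤ 2 S₀ S (≤-trans (≤-reflexive 2+S₀≡2n) 2n≤2+S)

    -- As 16 = 4², the exponents of 4 add up to n + 2k + m.
    K*bound : K * (27 ^ k * 4 ^ m) ≡ 27 ^ k * 4 ^ S₀
    K*bound = begin
      4 ^ n * 16 ^ k * (27 ^ k * 4 ^ m)        ≡⟨ rearrange (4 ^ n) (16 ^ k) (27 ^ k) (4 ^ m) ⟩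
      27 ^ k * (4 ^ n * 16 ^ k * 4 ^ m)        ≡⟨ cong (λ z → 27 ^ k * (4 ^ n * z * 4 ^ m)) (^-*-assoc 4 2 k) ⟩
      27 ^ k * (4 ^ n * 4 ^ (2 * k) * 4 ^ m)   ≡⟨ cong (λ z → 27 ^ k * (z * 4 ^ m)) (^-distribˡ-+-* 4 n (2 * k)) ⟨
      27 ^ k * (4 ^ (n + 2 * k) * 4 ^ m)       ≡⟨ cong (27 ^ k *_) (^-distribˡ-+-* 4 (n + 2 * k) m) ⟨
      27 ^ k * 4 ^ S₀ ∎
      where
      open ≡-Reasoning
      rearrange : ∀ a b c e → a * b * (c * e) ≡ c * (a * b * e)
      rearrange = solve-∀

    K*bound≤product-lower : K * (27 ^ k * 4 ^ m) ≤ Π.⨀ V lower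
    K*bound≤product-lower = begin
      K * (27 ^ k * 4 ^ m)   ≡⟨ K*bound ⟩
      27 ^ k * 4 ^ S₀        ≤⟨ *-monoʳ-≤ (27 ^ k) (^-monoʳ-≤ 4 S₀≤S) ⟩
      27 ^ k * 4 ^ S         ≡⟨ product-lower ⟨
      Π.⨀ V lower            ∎
      where open ≤-Reasoning

  -- After multiplication by `K`, the degree sum bound gives the first inequality and the bounds at
  -- the single vertices give the second.
  Π₂-bound : 27 ^ k * 4 ^ m ≤ Π₂ G
  Π₂-bound = *-cancelˡ-≤ K (begin
    K * (27 ^ k * 4 ^ m)   ≤⟨ K*bound≤product-lower ⟩
    Π.⨀ V lower            ≤⟨ product-mono-≤ lower≤upper V ⟩
    Π.⨀ V upper            ≡⟨ product-upper ⟩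
    K * Π₂ G               ∎)
    where open ≤-Reasoning

  module _ (Π₂≡ : Π₂ G ≡ 27 ^ k * 4 ^ m) where

    private
      upper≡K*bound : Π.⨀ V upper ≡ K * (27 ^ k * 4 ^ m)
      upper≡K*bound = trans product-upper (cong (K *_) Π₂≡)

      -- The assumed equality closes the chain behind `Π₂-bound`, so the product of `upper` is at
      -- most that of `lower`.
      lower≡upper : ∀ v → lower v ≡ upper v
      lower≡upper v = product-squeeze lower>0 lower≤upper V
        (≤-trans (≤-reflexive upper≡K*bound) K*bound≤product-lower) (∈-allFin v)

      -- A larger degree sum would make the power of 4 in the product of `lower` strictly larger and
      -- break the closed chain.
      S≡S₀ : S ≡ S₀
      S≡S₀ = ≤-antisym (≮⇒≥ S₀≮S) S₀≤S
        where
        open ≤-Reasoning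
        S₀≮S : ¬ S₀ < S
        S₀≮S S₀<S = <-irrefl refl (begin-strict
          27 ^ k * 4 ^ S₀        <⟨ *-monoʳ-< (27 ^ k) ⦃ m^n≢0 27 k ⦄ (^-monoʳ-< 4 (s≤s (s≤s z≤n)) S₀<S) ⟩
          27 ^ k * 4 ^ S         ≡⟨ product-lower ⟨
          Π.⨀ V lower            ≤⟨ product-mono-≤ lower≤upper V ⟩
          Π.⨀ V upper            ≡⟨ upper≡K*bound ⟩
          K * (27 ^ k * 4 ^ m)   ≡⟨ K*bound ⟩
          27 ^ k * 4 ^ S₀        ∎)

      degree-max : ∀ v → d v ≡ maxDegree G → d v ≡ 3
      degree-max v ≡max = factors≡⇒≡3 (max? v) (d v) (lower≡upper v) ≡max (max⇒3≤d v ≡max)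

      degree-other : ∀ v → ¬ d v ≡ maxDegree G → d v ≡ 1 ⊎ d v ≡ 2
      degree-other v ≢max = factors≡⇒≡1⊎≡2 (max? v) (d v) (lower≡upper v) ≢max

      -- The hypotheses count the vertices and sum the degrees; substituting the value of `b + c`
      -- from the first into the second leaves `b` alone.
      counts : ∀ b c → k + (b + c) ≡ 2 * k + 2 + m → k * 3 + (b * 2 + c * 1) ≡ n + 2 * k + m →
        b ≡ m × c ≡ k + 2
      counts b c eq₁ eq₂ = b≡m , c≡k+2
        where
        open ≡-Reasoning
        b+c≡ : b + c ≡ k + 2 + m
        b+c≡ = +-cancelˡ-≡ k _ _ (trans eq₁ (rearrange k m))
          where
          rearrange : ∀ k m → 2 * k + 2 + m ≡ k + (k + 2 + m)
          rearrange = solve-∀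
        b≡m : b ≡ m
        b≡m = +-cancelˡ-≡ (4 * k + 2 + m) b m (begin
          4 * k + 2 + m + b              ≡⟨ rearrange₁ k m b ⟩
          k * 3 + (b + (k + 2 + m))      ≡⟨ cong (λ z → k * 3 + (b + z)) b+c≡ ⟨
          k * 3 + (b + (b + c))          ≡⟨ rearrange₂ k b c ⟩
          k * 3 + (b * 2 + c * 1)        ≡⟨ eq₂ ⟩
          n + 2 * k + m                  ≡⟨ cong (λ z → z + 2 * k + m) n≡ ⟩
          2 * k + 2 + m + 2 * k + m      ≡⟨ rearrange₃ k m ⟩
          4 * k + 2 + m + m              ∎)
          where
          rearrange₁ : ∀ k m b → 4 * k + 2 + m + b ≡ k * 3 + (b + (k + 2 + m))
          rearrange₁ = solve-∀
          rearrange₂ : ∀ k b c → k * 3 + (b + (b + c)) ≡ k * 3 + (b * 2 + c * 1)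
          rearrange₂ = solve-∀
          rearrange₃ : ∀ k m → 2 * k + 2 + m + 2 * k + m ≡ 4 * k + 2 + m + m
          rearrange₃ = solve-∀
        c≡k+2 : c ≡ k + 2
        c≡k+2 = +-cancelˡ-≡ m c (k + 2)
          (trans (cong (_+ c) (sym b≡m)) (trans b+c≡ (+-comm (k + 2) m)))

    extremal⇒↭ : degrees G ↭ descending k m (k + 2)
    extremal⇒↭
      with b , c , degs↭ ← ↭-descending max? d V (λ {v} _ → degree-max v) (λ {v} _ → degree-other v)
      rewrite #max≡k
      with refl , refl ← counts b c
             (trans (sym (length-descending k b c))
               (trans (sym (↭-length degs↭)) (trans (length-map d V) (trans |V|≡n n≡))))
             (trans (sym (sum-descending k b c)) (trans (sym (sum-↭ degs↭)) S≡S₀))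
      = degs↭

  -- As a product of eᵉ over all degrees e, the index depends only on the multiset of degrees.
  ↭⇒extremal : degrees G ↭ descending k m (k + 2) → Π₂ G ≡ 27 ^ k * 4 ^ m
  ↭⇒extremal degs↭ = begin
    Π₂ G                                              ≡⟨ Π₂≡∏d^d G ⟩
    Π.⨀ V (λ v → d v ^ d v)                           ≡⟨ cong product (map-∘ V) ⟩
    Π.⨀ (degrees G) (λ e → e ^ e)                     ≡⟨ product-↭ (map⁺ (λ e → e ^ e) degs↭) ⟩
    Π.⨀ (descending k m (k + 2)) (λ e → e ^ e)        ≡⟨ product-descending k m (k + 2) ⟩
    27 ^ k * 4 ^ m ∎
    where open ≡-Reasoning

theorem4p1 : (n k : ℕ) → 1 ≤ k → 2 * k + 2 ≤ n → (T : Graph n) → 𝒯 n k T →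
    (Π₂ T ≥ (3 ^ 3) ^ k * (2 ^ 2) ^ (n ∸ 2 * k ∸ 2))
    × (+ ((3 ^ 3) ^ k * (2 ^ 2) ^ (n ∸ 2 * k ∸ 2)) / 1
    ≡ ((+ 27 / 16) ^ℚ k) *ℚ ((+ 4 / 1) ^ℚ (n ∸ 2)))
    × (Π₂ T ≡ (3 ^ 3) ^ k * (2 ^ 2) ^ (n ∸ 2 * k ∸ 2)
    ⇔ degreeSequence T ≡ replicate k 3 ++ replicate (n ∸ 2 * k ∸ 2) 2 ++ replicate (k + 2) 1)
theorem4p1 n k 1≤k 2k+2≤n T ((connected , _) , #max≡k) =
    -- `3 ^ 3` and `2 ^ 2` evaluate to 27 and 4, so the bound has the required form as it stands.
    Π₂-bound n≡ 1≤k T connected #max≡k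
  , trans (rational-form k m) (cong (λ e → (+ 27 / 16) ^ℚ k *ℚ ι 4 ^ℚ e) (sym n∸2≡))
  , mk⇔ (λ Π₂≡ → from (extremal⇒↭ n≡ 1≤k T connected #max≡k Π₂≡))
        (λ seq≡ → ↭⇒extremal n≡ 1≤k T connected #max≡k (to seq≡))
  where
  open Equivalence (degreeSequence≡⇔↭ T (descending-↘ k (n ∸ 2 * k ∸ 2) (k + 2)))
  m : ℕ
  m = n ∸ 2 * k ∸ 2
  n≡ : n ≡ 2 * k + 2 + m
  -- The hypothesis `2k+2≤n` makes the truncated subtractions exact.
  n≡ = trans (sym (m+[n∸m]≡n 2k+2≤n)) (cong (λ z → 2 * k + 2 + z) (sym (∸-+-assoc n (2 * k) 2)))
  n∸2≡ : n ∸ 2 ≡ 2 * k + m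
  n∸2≡ = trans (cong (_∸ 2) (trans n≡ (rearrange k m))) (m+n∸n≡m (2 * k + m) 2)
    where
    rearrange : ∀ k m → 2 * k + 2 + m ≡ 2 * k + m + 2
    rearrange = solve-∀
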